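{- Let $ABC$ be a non-obtuse triangle with edge lengths $a\geq b\geq c$. The smallest and largest possible worst-case evacuation costs of OppositeSearch, when starting from the smallest edge $c$, are \begin{align*} l_c(a,b,c) &= \frac{a+b+c}2, \\ u_c(a,b,c) & = a+ c. \end{align*}
   Context: OppositeSearch algorithm: two agents start at the same point $P$ on the perimeter of the triangle at time $0$ and traverse the perimeter in opposite directions at unit speed (until the whole perimeter is explored, i.e. until they meet after time equal to half the perimeter). For a point $I$ of the perimeter (the exit), the evacuation time is $t_I+d_I$, where $t_I$ is the first time an agent is at $I$ and $d_I$ is the Euclidean distance from $I$ to the other agent's position at time $t_I$. The worst-case evacuation cost $W(P)$ is the supremum of the evacuation time over all points $I$ of the perimeter. For an edge $i\in\{a,b,c\}$ (a closed segment, named by its length), $l_i(a,b,c)=\min_{P\in i}W(P)$ and $u_i(a,b,c)=\max_{P\in i}W(P)$. -}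

module Defs where

open import Algebra.Structures using (IsCommutativeRing)
open import Data.Bool.Base using (if_then_else_)
open import Data.List.Base using (List; []; _∷_)
open import Data.Product using (_×_; _,_; ∃; ∃-syntax)
open import Data.Sum using (_⊎_)
open import Relation.Binary.Core using (Rel)
open import Relation.Binary.PropositionalEquality using (_≡_; _≢_)
open import Relation.Binary.Structures using (IsDecTotalOrder)
open import Relation.Nullary using (does)
open import Relation.Unary using (Pred; _∈_; Satisfiable)
open import Level using (0ℓ)

-- The real numbers of classical mathematics, as a complete ordered field.
-- Inverses, square roots and suprema are total operations whose values are
-- unspecified where the corresponding axiom does not apply.
record RealNumbers : Set₁ where
  infixl 6 _+_ _-_
  infixl 7 _*_ _/_
  infix  8 -_ _⁻¹
  infix  4 _≤_
  field
    ℝ       : Set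
    _+_ _*_ : ℝ → ℝ → ℝ
    -_ _⁻¹  : ℝ → ℝ
    0# 1#   : ℝ
    _≤_     : Rel ℝ 0ℓ
    √       : ℝ → ℝ

    isCommutativeRing : IsCommutativeRing _≡_ _+_ _*_ -_ 0# 1#
    0≢1               : 0# ≢ 1#
    *-inverseʳ        : ∀ x → x ≢ 0# → x * x ⁻¹ ≡ 1#

    isDecTotalOrder   : IsDecTotalOrder _≡_ _≤_
    +-monoˡ-≤         : ∀ z {x y} → x ≤ y → x + z ≤ y + z
    *-nonneg          : ∀ {x y} → 0# ≤ x → 0# ≤ y → 0# ≤ x * y

    √-nonneg          : ∀ {x} → 0# ≤ x → 0# ≤ √ x
    √-square          : ∀ {x} → 0# ≤ x → √ x * √ x ≡ x

  UpperBound : Pred ℝ 0ℓ → Pred ℝ 0ℓ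
  UpperBound S u = ∀ x → x ∈ S → x ≤ u

  IsSupremum : Pred ℝ 0ℓ → Pred ℝ 0ℓ
  IsSupremum S u = UpperBound S u × (∀ v → UpperBound S v → u ≤ v)

  field
    sup            : Pred ℝ 0ℓ → ℝ
    sup-isSupremum : ∀ S → Satisfiable S → ∃ (UpperBound S) → IsSupremum S (sup S)

  open IsDecTotalOrder isDecTotalOrder public using (_≤?_)

  _-_ : ℝ → ℝ → ℝ
  x - y = x + (- y)

  _/_ : ℝ → ℝ → ℝ
  x / y = x * y ⁻¹

  2# : ℝ
  2# = 1# + 1#

module Plane (R : RealNumbers) where
  open RealNumbers R

  infixl 6 _⊕_ _⊖_
  infixl 7 _·_ _∙_

  Point : Set
  Point = ℝ × ℝ

  _⊕_ _⊖_ : Point → Point → Point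
  (x , y) ⊕ (x′ , y′) = x + x′ , y + y′
  (x , y) ⊖ (x′ , y′) = x - x′ , y - y′

  _·_ : ℝ → Point → Point
  r · (x , y) = r * x , r * y

  _∙_ : Point → Point → ℝ
  (x , y) ∙ (x′ , y′) = x * x′ + y * y′

  det : Point → Point → ℝ
  det (x , y) (x′ , y′) = x * y′ - y * x′

  dist : Point → Point → ℝ
  dist X Y = √ ((X ⊖ Y) ∙ (X ⊖ Y))

  OnSegment : Point → Point → Pred Point 0ℓ
  OnSegment X Y P = ∃[ s ] 0# ≤ s × s ≤ 1# × P ≡ X ⊕ s · (Y ⊖ X)

  IsTriangle : Point → Point → Point → Set
  IsTriangle A B C = det (B ⊖ A) (C ⊖ A) ≢ 0#

  -- The angle XVY is at most a right angle.
  NonObtuseAngle : Point → Point → Point → Set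
  NonObtuseAngle X V Y = 0# ≤ (X ⊖ V) ∙ (Y ⊖ V)

  NonObtuse : Point → Point → Point → Set
  NonObtuse A B C =
    NonObtuseAngle B A C × NonObtuseAngle C B A × NonObtuseAngle A C B

  -- Position after time t of an agent that starts at P and visits the listed
  -- points in order, in straight lines and at unit speed.
  walk : Point → List Point → ℝ → Point
  walk P []       t = P
  walk P (V ∷ Vs) t =
    if does (t ≤? dist P V)
    then P ⊕ (t / dist P V) · (V ⊖ P)
    else walk V Vs (t - dist P V)

  -- The search on triangle XYZ from a starting point P of the edge XY.  The
  -- other edges are covered by renaming the vertices; at a shared vertex the
  -- two descriptions give the same pair of trajectories.
  module OppositeSearch (X Y Z P : Point) where

    halfPerimeter : ℝ
    halfPerimeter = (dist X Y + dist Y Z + dist Z X) / 2#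

    OnPerimeter : Pred Point 0ℓ
    OnPerimeter I = OnSegment X Y I ⊎ OnSegment Y Z I ⊎ OnSegment Z X I

    agent₁ agent₂ : ℝ → Point
    agent₁ = walk P (Y ∷ Z ∷ X ∷ P ∷ [])
    agent₂ = walk P (X ∷ Z ∷ Y ∷ P ∷ [])

    VisitedAt : Point → Pred ℝ 0ℓ
    VisitedAt I t =
      0# ≤ t × t ≤ halfPerimeter × (agent₁ t ≡ I ⊎ agent₂ t ≡ I)

    FirstVisitedAt : Point → Pred ℝ 0ℓ
    FirstVisitedAt I t = VisitedAt I t × (∀ s → VisitedAt I s → t ≤ s)

    EvacuationTime : Point → Pred ℝ 0ℓ
    EvacuationTime I e = ∃[ t ] FirstVisitedAt I t ×
      ( (agent₁ t ≡ I × e ≡ t + dist I (agent₂ t))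
      ⊎ (agent₂ t ≡ I × e ≡ t + dist I (agent₁ t)))

    worstCase : ℝ
    worstCase = sup λ e → ∃[ I ] OnPerimeter I × EvacuationTime I e

  W : Point → Point → Point → Point → ℝ
  W X Y Z P = OppositeSearch.worstCase X Y Z P

  IsMinimumOver IsMaximumOver : Pred Point 0ℓ → (Point → ℝ) → Pred ℝ 0ℓ
  IsMinimumOver S f m = (∃[ P ] P ∈ S × f P ≡ m) × (∀ P → P ∈ S → m ≤ f P)
  IsMaximumOver S f m = (∃[ P ] P ∈ S × f P ≡ m) × (∀ P → P ∈ S → f P ≤ m)

{-
Let p, q be the distances from the starting point P to X and Y, let XY be the shortest side, and put
x = |YZ|, y = |XZ|, so that 2h = (p + y) + (q + x).  While both agents move along straight lines the
evacuation time t + dist is a convex function of t, so it suffices to bound it at the times at which an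
agent turns and at the meeting time h.  At these times it is at most max (q + x) (p + y), and it equals
this maximum when the first of the agents reaches Z.  Hence h ≤ W P ≤ max (q + x) (p + y), where
the lower bound is the cost of the meeting point.  Both bounds agree for the P with q + x = p + y, and
P = A makes q + x = c + a, its largest value.
-}
module Submission where

open import Algebra.Bundles using (CommutativeRing)
open import Algebra.Solver.Ring.AlmostCommutativeRing using (fromCommutativeRing; _-Raw-AlmostCommutative⟶_)
open import Data.Empty using (⊥-elim)
open import Data.Integer.Base as ℤ using (ℤ; -[1+_])
import Data.Integer.Properties as ℤ
open import Data.List.Base using ([]; _∷_)
open import Data.Maybe.Base using (Maybe; just; nothing)
open import Data.Nat.Base as ℕ using (ℕ; zero; suc)
open import Data.Product using (_×_; _,_; proj₁; proj₂; ∃-syntax)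
open import Data.Sum using (_⊎_; inj₁; inj₂)
open import Defs
open import Level using (0ℓ)
open import Relation.Binary.PropositionalEquality using (_≡_; _≢_; refl; sym; trans; cong; cong₂; subst; subst₂)
open import Relation.Binary.Structures using (IsDecTotalOrder)
open import Relation.Nullary using (yes; no)
import Algebra.Solver.Ring as RingSolver

-- A ring solver with integer coefficients.

module IntegerCoefficients (CR : CommutativeRing 0ℓ 0ℓ) where
  open CommutativeRing CR renaming (refl to ≈-refl; sym to ≈-sym; trans to ≈-trans)
  open import Algebra.Properties.Ring ring
  open import Algebra.Properties.AbelianGroup +-abelianGroup using (⁻¹-∙-comm; ⁻¹-involutive; ε⁻¹≈ε)
  open import Algebra.Properties.Semiring.Mult.TCOptimised semiring using (×-homo-+; ×1-homo-*; 1+×) renaming (_×_ to _×′_)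
  open import Relation.Binary.Reasoning.Setoid setoid

  -- With the optimised multiple, `fromℕ 1` computes to `1#` itself, not to a sum with `0#`. Hence
  -- `:0` and `:1` stand for the field constants up to `refl`.
  fromℕ : ℕ → Carrier
  fromℕ n = n ×′ 1#

  fromℤ : ℤ → Carrier
  fromℤ (ℤ.+ n)    = fromℕ n
  fromℤ (-[1+ n ]) = - fromℕ (suc n)

  fromℤ-⊖ : ∀ m n → fromℤ (m ℤ.⊖ n) ≈ fromℕ m - fromℕ n
  fromℤ-⊖ m zero = ≈-sym (≈-trans (+-congˡ ε⁻¹≈ε) (+-identityʳ _))
  fromℤ-⊖ zero (suc n) = ≈-sym (+-identityˡ _)
  fromℤ-⊖ (suc m) (suc n) = begin
    fromℤ (suc m ℤ.⊖ suc n)                     ≡⟨ cong fromℤ (ℤ.[1+m]⊖[1+n]≡m⊖n m n) ⟩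
    fromℤ (m ℤ.⊖ n)                             ≈⟨ fromℤ-⊖ m n ⟩
    fromℕ m - fromℕ n                         ≈⟨ +-identityˡ _ ⟨
    0# + (fromℕ m - fromℕ n)                  ≈⟨ +-congʳ (-‿inverseʳ 1#) ⟨
    1# - 1# + (fromℕ m - fromℕ n)             ≈⟨ interchange 1# (- 1#) (fromℕ m) (- fromℕ n) ⟩
    (1# + fromℕ m) + (- 1# - fromℕ n)         ≈⟨ +-cong (1+× m 1#) (≈-trans (-‿cong (1+× n 1#)) (≈-sym (⁻¹-∙-comm 1# (fromℕ n)))) ⟨
    fromℕ (suc m) - fromℕ (suc n)             ∎
    where open import Algebra.Properties.CommutativeSemigroup +-commutativeSemigroup using (interchange)

  fromℤ-neg : ∀ i → fromℤ (ℤ.- i) ≈ - fromℤ i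
  fromℤ-neg (ℤ.+ zero)  = ≈-sym ε⁻¹≈ε
  fromℤ-neg (ℤ.+ suc n) = ≈-refl
  fromℤ-neg -[1+ n ]    = ≈-sym (⁻¹-involutive _)

  fromℤ-+ : ∀ i j → fromℤ (i ℤ.+ j) ≈ fromℤ i + fromℤ j
  fromℤ-+ (ℤ.+ m)  (ℤ.+ n)  = ×-homo-+ 1# m n
  fromℤ-+ (ℤ.+ m)  -[1+ n ] = fromℤ-⊖ m (suc n)
  fromℤ-+ -[1+ m ] (ℤ.+ n)  = ≈-trans (fromℤ-⊖ n (suc m)) (+-comm _ _)
  fromℤ-+ -[1+ m ] -[1+ n ] = begin
    - fromℕ (suc (suc (m ℕ.+ n)))       ≡⟨ cong (λ k → - fromℕ (suc k)) (sym (+-suc m n)) ⟩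
    - fromℕ (suc m ℕ.+ suc n)           ≈⟨ -‿cong (×-homo-+ 1# (suc m) (suc n)) ⟩
    - (fromℕ (suc m) + fromℕ (suc n))   ≈⟨ ⁻¹-∙-comm _ _ ⟨
    - fromℕ (suc m) - fromℕ (suc n)     ∎
    where open import Data.Nat.Properties using (+-suc)

  fromℤ-*ˡ⁺ : ∀ m j → fromℤ (ℤ.+ m ℤ.* j) ≈ fromℕ m * fromℤ j
  fromℤ-*ˡ⁺ m (ℤ.+ n) = begin
    fromℤ (ℤ.+ m ℤ.* ℤ.+ n)  ≡⟨ cong fromℤ (ℤ.pos-* m n) ⟨
    fromℕ (m ℕ.* n)          ≈⟨ ×1-homo-* m n ⟩
    fromℕ m * fromℕ n        ∎
  fromℤ-*ˡ⁺ m -[1+ n ] = begin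
    fromℤ (ℤ.+ m ℤ.* ℤ.- ℤ.+ suc n)      ≡⟨ cong fromℤ (ℤ.neg-distribʳ-* (ℤ.+ m) (ℤ.+ suc n)) ⟨
    fromℤ (ℤ.- (ℤ.+ m ℤ.* ℤ.+ suc n))    ≈⟨ fromℤ-neg (ℤ.+ m ℤ.* ℤ.+ suc n) ⟩
    - fromℤ (ℤ.+ m ℤ.* ℤ.+ suc n)        ≈⟨ -‿cong (fromℤ-*ˡ⁺ m (ℤ.+ suc n)) ⟩
    - (fromℕ m * fromℕ (suc n))          ≈⟨ -‿distribʳ-* _ _ ⟩
    fromℕ m * - fromℕ (suc n)            ∎

  fromℤ-* : ∀ i j → fromℤ (i ℤ.* j) ≈ fromℤ i * fromℤ j
  fromℤ-* (ℤ.+ m)  j = fromℤ-*ˡ⁺ m j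
  fromℤ-* -[1+ m ] j = begin
    fromℤ (ℤ.- ℤ.+ suc m ℤ.* j)          ≡⟨ cong fromℤ (ℤ.neg-distribˡ-* (ℤ.+ suc m) j) ⟨
    fromℤ (ℤ.- (ℤ.+ suc m ℤ.* j))        ≈⟨ fromℤ-neg (ℤ.+ suc m ℤ.* j) ⟩
    - fromℤ (ℤ.+ suc m ℤ.* j)            ≈⟨ -‿cong (fromℤ-*ˡ⁺ (suc m) j) ⟩
    - (fromℕ (suc m) * fromℤ j)          ≈⟨ -‿distribˡ-* _ _ ⟩
    - fromℕ (suc m) * fromℤ j            ∎

  morphism : CommutativeRing.rawRing ℤ.+-*-commutativeRing -Raw-AlmostCommutative⟶ fromCommutativeRing CR
  morphism = record
    { ⟦_⟧ = fromℤ ; +-homo = fromℤ-+ ; *-homo = fromℤ-* ; -‿homo = fromℤ-neg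
    ; 0-homo = ≈-refl ; 1-homo = ≈-refl }

  coefficient≟ : ∀ i j → Maybe (fromℤ i ≈ fromℤ j)
  coefficient≟ i j with i ℤ.≟ j
  ... | yes refl = just ≈-refl
  ... | no  _    = nothing

  open RingSolver (CommutativeRing.rawRing ℤ.+-*-commutativeRing) (fromCommutativeRing CR) morphism coefficient≟ public
    using (Polynomial; solve; _:=_; _:+_; _:*_; :-_; _:-_; con)

  :0 :1 : ∀ {n} → Polynomial n
  :0 = con ℤ.0ℤ
  :1 = con ℤ.1ℤ

-- Ordered field arithmetic.

module OrderedField (R : RealNumbers) where
  open RealNumbers R
  open IsDecTotalOrder isDecTotalOrder public
    using (total; antisym; _≟_) renaming (refl to ≤-refl; trans to ≤-trans; reflexive to ≤-reflexive)

  commutativeRing : CommutativeRing 0ℓ 0ℓ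
  commutativeRing = record { isCommutativeRing = isCommutativeRing }
  open CommutativeRing commutativeRing public
    using (+-comm; *-comm; +-identityˡ; +-identityʳ; *-identityˡ; *-identityʳ; zeroˡ; zeroʳ; -‿inverseʳ)
  open IntegerCoefficients commutativeRing public
    using (solve; _:=_; _:+_; _:*_; :-_; _:-_; :0; :1)

  -- The pattern for linear inequalities throughout: add up known inequalities with `+-mono-≤` to
  -- get `u ≤ v`, and leave to the ring solver that both differences agree.
  ≤-by-difference : ∀ {u v x y} → u ≤ v → y - x ≡ v - u → x ≤ y
  ≤-by-difference {u} {v} {x} {y} u≤v eq = subst₂ _≤_
    (solve 2 (λ u x → u :+ (x :- u) := x) refl u x)
    (trans (solve 3 (λ u v x → v :+ (x :- u) := v :- u :+ x) refl u v x)
      (trans (cong (_+ x) (sym eq)) (solve 2 (λ x y → y :- x :+ x := y) refl x y)))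
    (+-monoˡ-≤ (x - u) u≤v)

  +-mono-≤ : ∀ {u v x y} → u ≤ v → x ≤ y → u + x ≤ v + y
  +-mono-≤ {u} {v} {x} {y} u≤v x≤y = ≤-trans (+-monoˡ-≤ x u≤v)
    (≤-by-difference x≤y (solve 3 (λ v x y → v :+ y :- (v :+ x) := y :- x) refl v x y))

  +-nonneg : ∀ {x y} → 0# ≤ x → 0# ≤ y → 0# ≤ x + y
  +-nonneg 0≤x 0≤y = subst (_≤ _) (+-identityˡ 0#) (+-mono-≤ 0≤x 0≤y)

  sub-nonneg : ∀ {x y} → x ≤ y → 0# ≤ y - x
  sub-nonneg {x} {y} x≤y = ≤-by-difference x≤y (solve 2 (λ x y → y :- x :- :0 := y :- x) refl x y)

  *-monoˡ-≤ : ∀ {x y z} → 0# ≤ z → x ≤ y → z * x ≤ z * y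
  *-monoˡ-≤ {x} {y} {z} 0≤z x≤y = ≤-by-difference (*-nonneg 0≤z (sub-nonneg x≤y))
    (solve 3 (λ x y z → z :* y :- z :* x := z :* (y :- x) :- :0) refl x y z)

  square-nonneg : ∀ x → 0# ≤ x * x
  square-nonneg x with total 0# x
  ... | inj₁ 0≤x = *-nonneg 0≤x 0≤x
  ... | inj₂ x≤0 = subst (0# ≤_) (solve 1 (λ x → (:0 :- x) :* (:0 :- x) := x :* x) refl x)
                     (*-nonneg (sub-nonneg x≤0) (sub-nonneg x≤0))

  0≤1 : 0# ≤ 1#
  0≤1 = subst (0# ≤_) (*-identityˡ 1#) (square-nonneg 1#)

  0≤2 : 0# ≤ 2#
  0≤2 = +-nonneg 0≤1 0≤1

  2≢0 : 2# ≢ 0#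
  2≢0 2≡0 = 0≢1 (antisym 0≤1 (≤-by-difference 0≤1
    (trans (cong (_- 1#) (sym 2≡0)) (solve 0 (:1 :+ :1 :- :1 := :1 :- :0) refl))))

  *-cancelˡ : ∀ {x y z} → z ≢ 0# → z * x ≡ z * y → x ≡ y
  *-cancelˡ {x} {y} {z} z≢0 eq = trans (cancel x) (trans (cong (z ⁻¹ *_) eq) (sym (cancel y)))
    where
    cancel : ∀ w → w ≡ z ⁻¹ * (z * w)
    cancel w = trans (sym (*-identityˡ w)) (trans (cong (_* w) (sym (*-inverseʳ z z≢0)))
      (solve 3 (λ z i w → z :* i :* w := i :* (z :* w)) refl z (z ⁻¹) w))

  *-cancelˡ-≤ : ∀ {x y z} → 0# ≤ z → z ≢ 0# → z * x ≤ z * y → x ≤ y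
  *-cancelˡ-≤ {x} {y} 0≤z z≢0 zx≤zy with total x y
  ... | inj₁ x≤y = x≤y
  ... | inj₂ y≤x = ≤-reflexive (*-cancelˡ z≢0 (antisym zx≤zy (*-monoˡ-≤ 0≤z y≤x)))

  -- The inverse of `x` is `x` times the square of that inverse.
  ⁻¹-nonneg : ∀ {x} → 0# ≤ x → x ≢ 0# → 0# ≤ x ⁻¹
  ⁻¹-nonneg {x} 0≤x x≢0 = subst (0# ≤_)
    (trans (solve 2 (λ x i → x :* (i :* i) := x :* i :* i) refl x (x ⁻¹))
      (trans (cong (_* x ⁻¹) (*-inverseʳ x x≢0)) (*-identityˡ _)))
    (*-nonneg 0≤x (square-nonneg (x ⁻¹)))

  *-/-cancel : ∀ x y → y ≢ 0# → x / y * y ≡ x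
  *-/-cancel x y y≢0 = trans (solve 3 (λ x y i → x :* i :* y := x :* (y :* i)) refl x y (y ⁻¹))
    (trans (cong (x *_) (*-inverseʳ y y≢0)) (*-identityʳ x))

  x*x≡0⇒x≡0 : ∀ {x} → x * x ≡ 0# → x ≡ 0#
  x*x≡0⇒x≡0 {x} eq with x ≟ 0#
  ... | yes x≡0 = x≡0
  ... | no  x≢0 = *-cancelˡ x≢0 (trans eq (sym (zeroʳ x)))

  x+y≡0⇒x≡0 : ∀ {x y} → 0# ≤ x → 0# ≤ y → x + y ≡ 0# → x ≡ 0#
  x+y≡0⇒x≡0 {x} {y} 0≤x 0≤y eq = antisym
    (≤-by-difference 0≤y (trans (cong (_- x) (sym eq)) (solve 2 (λ x y → x :+ y :- x := y :- :0) refl x y))) 0≤x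

  -- If `y ≤ x`, then `x² - 2xy + y² ≤ 2y² - 2xy ≤ 0`, so the square of `x - y` vanishes. All
  -- inequalities between norms are reduced to squares this way.
  square-cancel-≤ : ∀ {x y} → 0# ≤ y → x * x ≤ y * y → x ≤ y
  square-cancel-≤ {x} {y} 0≤y xx≤yy with total x y
  ... | inj₁ x≤y = x≤y
  ... | inj₂ y≤x = ≤-reflexive (trans (solve 2 (λ x y → x := x :- y :+ y) refl x y)
                     (trans (cong (_+ y) (x*x≡0⇒x≡0 (antisym [x-y]²≤0 (square-nonneg _)))) (+-identityˡ y)))
    where
    [x-y]²≤0 : (x - y) * (x - y) ≤ 0#
    [x-y]²≤0 = ≤-by-difference (+-mono-≤ xx≤yy (*-monoˡ-≤ (+-nonneg 0≤y 0≤y) y≤x))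
      (solve 2 (λ x y → :0 :- (x :- y) :* (x :- y) := y :* y :+ (y :+ y) :* x :- (x :* x :+ (y :+ y) :* y)) refl x y)

  square-injective : ∀ {x y} → 0# ≤ x → 0# ≤ y → x * x ≡ y * y → x ≡ y
  square-injective 0≤x 0≤y eq =
    antisym (square-cancel-≤ 0≤y (≤-reflexive eq)) (square-cancel-≤ 0≤x (≤-reflexive (sym eq)))

  halve : ∀ {s t} → s + s ≤ t + t → s ≤ t
  halve {s} {t} ss≤tt = *-cancelˡ-≤ 0≤2 2≢0 (subst₂ _≤_ (double s) (double t) ss≤tt)
    where
    double : ∀ s → s + s ≡ 2# * s
    double = solve 1 (λ s → s :+ s := (:1 :+ :1) :* s) refl

-- Norms, distances and segments in the plane.

module PlaneGeometry (R : RealNumbers) where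
  open RealNumbers R
  open Plane R
  open OrderedField R

  ‖_‖ : Point → ℝ
  ‖ v ‖ = √ (v ∙ v)

  ∙-nonneg : ∀ v → 0# ≤ v ∙ v
  ∙-nonneg (x , y) = +-nonneg (square-nonneg x) (square-nonneg y)

  ‖‖-nonneg : ∀ v → 0# ≤ ‖ v ‖
  ‖‖-nonneg v = √-nonneg (∙-nonneg v)

  ‖‖-square : ∀ v → ‖ v ‖ * ‖ v ‖ ≡ v ∙ v
  ‖‖-square v = √-square (∙-nonneg v)

  ‖‖-· : ∀ {k} → 0# ≤ k → ∀ v → ‖ k · v ‖ ≡ k * ‖ v ‖
  ‖‖-· {k} 0≤k v@(x , y) = square-injective (‖‖-nonneg (k · v)) (*-nonneg 0≤k (‖‖-nonneg v))
    (trans (‖‖-square (k · v))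
    (trans (solve 3 (λ k x y → k :* x :* (k :* x) :+ k :* y :* (k :* y) := k :* k :* (x :* x :+ y :* y)) refl k x y)
    (trans (cong (k * k *_) (sym (‖‖-square v)))
      (solve 2 (λ k n → k :* k :* (n :* n) := k :* n :* (k :* n)) refl k ‖ v ‖))))

  -- Lagrange's identity: the difference of the squares of the two sides is the square of `det u v`.
  cauchy-schwarz : ∀ u v → u ∙ v ≤ ‖ u ‖ * ‖ v ‖
  cauchy-schwarz u@(x , y) v@(z , w) = square-cancel-≤ (*-nonneg (‖‖-nonneg u) (‖‖-nonneg v))
    (subst (u ∙ v * (u ∙ v) ≤_)
      (trans (cong₂ _*_ (sym (‖‖-square u)) (sym (‖‖-square v)))
        (solve 2 (λ m n → m :* m :* (n :* n) := m :* n :* (m :* n)) refl ‖ u ‖ ‖ v ‖))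
      (≤-by-difference (square-nonneg (det u v))
        (solve 4 (λ x y z w →
          (x :* x :+ y :* y) :* (z :* z :+ w :* w) :- (x :* z :+ y :* w) :* (x :* z :+ y :* w)
            := (x :* w :- y :* z) :* (x :* w :- y :* z) :- :0) refl x y z w)))

  ‖‖-⊕ : ∀ u v → ‖ u ⊕ v ‖ ≤ ‖ u ‖ + ‖ v ‖
  ‖‖-⊕ u@(x , y) v@(z , w) = square-cancel-≤ (+-nonneg (‖‖-nonneg u) (‖‖-nonneg v))
    (subst₂ _≤_ (sym expand-left) (sym expand-right)
      (≤-by-difference (+-mono-≤ (cauchy-schwarz u v) (cauchy-schwarz u v))
        (solve 4 (λ a b c d → a :+ b :+ (c :+ c) :- (a :+ b :+ (d :+ d)) := c :+ c :- (d :+ d)) refl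
          (u ∙ u) (v ∙ v) (‖ u ‖ * ‖ v ‖) (u ∙ v))))
    where
    expand-left : ‖ u ⊕ v ‖ * ‖ u ⊕ v ‖ ≡ u ∙ u + v ∙ v + (u ∙ v + u ∙ v)
    expand-left = trans (‖‖-square (u ⊕ v))
      (solve 4 (λ x y z w → (x :+ z) :* (x :+ z) :+ (y :+ w) :* (y :+ w)
         := x :* x :+ y :* y :+ (z :* z :+ w :* w) :+ (x :* z :+ y :* w :+ (x :* z :+ y :* w))) refl x y z w)
    expand-right : (‖ u ‖ + ‖ v ‖) * (‖ u ‖ + ‖ v ‖) ≡ u ∙ u + v ∙ v + (‖ u ‖ * ‖ v ‖ + ‖ u ‖ * ‖ v ‖)
    expand-right = trans
      (solve 2 (λ m n → (m :+ n) :* (m :+ n) := m :* m :+ n :* n :+ (m :* n :+ m :* n)) refl ‖ u ‖ ‖ v ‖)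
      (cong (_+ (‖ u ‖ * ‖ v ‖ + ‖ u ‖ * ‖ v ‖)) (cong₂ _+_ (‖‖-square u) (‖‖-square v)))

  dist-nonneg : ∀ X Y → 0# ≤ dist X Y
  dist-nonneg X Y = ‖‖-nonneg (X ⊖ Y)

  dist-sym : ∀ X Y → dist X Y ≡ dist Y X
  dist-sym (x , x′) (y , y′) = cong √ (solve 4 (λ x x′ y y′ →
    (x :- y) :* (x :- y) :+ (x′ :- y′) :* (x′ :- y′) := (y :- x) :* (y :- x) :+ (y′ :- x′) :* (y′ :- x′)) refl x x′ y y′)

  dist-triangle : ∀ X Y Z → dist X Z ≤ dist X Y + dist Y Z
  dist-triangle X@(x , x′) Y@(y , y′) Z@(z , z′) =
    subst (λ v → ‖ v ‖ ≤ dist X Y + dist Y Z) (cong₂ _,_ (telescope x y z) (telescope x′ y′ z′)) (‖‖-⊕ (X ⊖ Y) (Y ⊖ Z))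
    where
    telescope : ∀ x y z → x - y + (y - z) ≡ x - z
    telescope = solve 3 (λ x y z → x :- y :+ (y :- z) := x :- z) refl

  dist≡0⇒≡ : ∀ {X Y} → dist X Y ≡ 0# → X ≡ Y
  dist≡0⇒≡ {X@(x , x′)} {Y@(y , y′)} d≡0 = cong₂ _,_
    (x-y≡0⇒x≡y (x+y≡0⇒x≡0 (square-nonneg _) (square-nonneg _) squares≡0))
    (x-y≡0⇒x≡y (x+y≡0⇒x≡0 (square-nonneg _) (square-nonneg _) (trans (+-comm _ _) squares≡0)))
    where
    squares≡0 : (X ⊖ Y) ∙ (X ⊖ Y) ≡ 0#
    squares≡0 = trans (sym (‖‖-square (X ⊖ Y))) (trans (cong (λ d → d * d) d≡0) (zeroˡ 0#))
    x-y≡0⇒x≡y : ∀ {x y} → (x - y) * (x - y) ≡ 0# → x ≡ y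
    x-y≡0⇒x≡y {x} {y} eq = trans (solve 2 (λ x y → x := x :- y :+ y) refl x y)
      (trans (cong (_+ y) (x*x≡0⇒x≡0 eq)) (+-identityˡ y))

  dist-self : ∀ X → dist X X ≡ 0#
  dist-self X@(x , x′) = x*x≡0⇒x≡0 (trans (‖‖-square (X ⊖ X))
    (solve 2 (λ x x′ → (x :- x) :* (x :- x) :+ (x′ :- x′) :* (x′ :- x′) := :0) refl x x′))

  ⊕-self : ∀ k V → V ⊕ k · (V ⊖ V) ≡ V
  ⊕-self k (x , y) = cong₂ _,_ (eq k x) (eq k y)
    where
    eq : ∀ k x → x + k * (x - x) ≡ x
    eq = solve 2 (λ k x → x :+ k :* (x :- x) := x) refl

  ⊕-0 : ∀ V u → V ⊕ 0# · u ≡ V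
  ⊕-0 (x , y) (z , w) = cong₂ _,_ (eq x z) (eq y w)
    where
    eq : ∀ x z → x + 0# * z ≡ x
    eq = solve 2 (λ x z → x :+ :0 :* z := x) refl

  segment-flip : ∀ {s t} X Y → s + t ≡ 1# → X ⊕ s · (Y ⊖ X) ≡ Y ⊕ t · (X ⊖ Y)
  segment-flip {s} {t} (x , x′) (y , y′) s+t≡1 = cong₂ _,_ (eq x y) (eq x′ y′)
    where
    eq : ∀ x y → x + s * (y - x) ≡ y + t * (x - y)
    eq x y = trans
      (solve 4 (λ s t x y → x :+ s :* (y :- x) := x :+ (s :+ t) :* (y :- x) :+ t :* (x :- y)) refl s t x y)
      (trans (cong (λ k → x + k * (y - x) + t * (x - y)) s+t≡1)
        (solve 3 (λ t x y → x :+ :1 :* (y :- x) :+ t :* (x :- y) := y :+ t :* (x :- y)) refl t x y))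

  OnSegment-sym : ∀ {X Y P} → OnSegment X Y P → OnSegment Y X P
  OnSegment-sym {X} {Y} (s , 0≤s , s≤1 , refl) = 1# - s , sub-nonneg s≤1
    , ≤-by-difference 0≤s (solve 1 (λ s → :1 :- (:1 :- s) := s :- :0) refl s)
    , segment-flip X Y (solve 1 (λ s → s :+ (:1 :- s) := :1) refl s)

  dist-segment : ∀ {s} X Y → 0# ≤ s → dist X (X ⊕ s · (Y ⊖ X)) ≡ s * dist X Y
  dist-segment {s} X@(x , x′) Y@(y , y′) 0≤s =
    trans (cong ‖_‖ (cong₂ _,_ (eq x y) (eq x′ y′))) (‖‖-· 0≤s (X ⊖ Y))
    where
    eq : ∀ x y → x - (x + s * (y - x)) ≡ s * (x - y)
    eq = solve 3 (λ s x y → x :- (x :+ s :* (y :- x)) := s :* (x :- y)) refl s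

  OnSegment⇒dist+dist : ∀ {X Y P} → OnSegment X Y P → dist P X + dist P Y ≡ dist X Y
  OnSegment⇒dist+dist {X} {Y} {P} (s , 0≤s , s≤1 , P≡) = trans
    (cong₂ _+_
      (trans (dist-sym P X) (trans (cong (dist X) P≡) (dist-segment X Y 0≤s)))
      (trans (dist-sym P Y) (trans (cong (dist Y) P≡′) (trans (dist-segment Y X (sub-nonneg s≤1)) (cong ((1# - s) *_) (dist-sym Y X))))))
    (solve 2 (λ s d → s :* d :+ (:1 :- s) :* d := d) refl s (dist X Y))
    where
    P≡′ : P ≡ Y ⊕ (1# - s) · (X ⊖ Y)
    P≡′ = trans P≡ (segment-flip X Y (solve 1 (λ s → s :+ (:1 :- s) := :1) refl s))

  -- Disks are convex: `Q ⊖ P` is the combination of `Q ⊖ X` and `Q ⊖ Y` with weights `1# - s` and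
  -- `s`.
  dist-segment-≤ : ∀ {X Y P K} Q → OnSegment X Y P → dist Q X ≤ K → dist Q Y ≤ K → dist Q P ≤ K
  dist-segment-≤ {X@(x , x′)} {Y@(y , y′)} {P} {K} Q@(q , q′) (s , 0≤s , s≤1 , refl) QX≤K QY≤K =
    ≤-trans (subst (_≤ ‖ (1# - s) · (Q ⊖ X) ‖ + ‖ s · (Q ⊖ Y) ‖) (cong ‖_‖ (cong₂ _,_ (eq q x y) (eq q′ x′ y′))) (‖‖-⊕ ((1# - s) · (Q ⊖ X)) (s · (Q ⊖ Y))))
    (subst₂ _≤_ (cong₂ _+_ (sym (‖‖-· (sub-nonneg s≤1) (Q ⊖ X))) (sym (‖‖-· 0≤s (Q ⊖ Y))))
      (solve 2 (λ s k → (:1 :- s) :* k :+ s :* k := k) refl s K)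
      (+-mono-≤ (*-monoˡ-≤ (sub-nonneg s≤1) QX≤K) (*-monoˡ-≤ 0≤s QY≤K)))
    where
    eq : ∀ q x y → (1# - s) * (q - x) + s * (q - y) ≡ q - (x + s * (y - x))
    eq = solve 4 (λ s q x y → (:1 :- s) :* (q :- x) :+ s :* (q :- y) := q :- (x :+ s :* (y :- x))) refl s

  det-self : ∀ u → det u u ≡ 0#
  det-self (x , y) = solve 2 (λ x y → x :* y :- y :* x := :0) refl x y

  det-⊖-self : ∀ u V → det u (V ⊖ V) ≡ 0#
  det-⊖-self (x , y) (v , v′) = solve 4 (λ x y v v′ → x :* (v′ :- v′) :- y :* (v :- v) := :0) refl x y v v′

  -- The determinant is affine in the second point, so it vanishes between two of its zeros. This
  -- keeps an agent on the line of the edge that it traverses.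
  det-segment : ∀ u O {V W N} → OnSegment V W N → det u (V ⊖ O) ≡ 0# → det u (W ⊖ O) ≡ 0# → det u (N ⊖ O) ≡ 0#
  det-segment u@(x , y) O@(o , o′) {V@(v , v′)} {W@(w , w′)} (s , _ , _ , refl) V≡0 W≡0 = trans
    (solve 9 (λ x y o o′ v v′ w w′ s →
      x :* (v′ :+ s :* (w′ :- v′) :- o′) :- y :* (v :+ s :* (w :- v) :- o)
        := (:1 :- s) :* (x :* (v′ :- o′) :- y :* (v :- o)) :+ s :* (x :* (w′ :- o′) :- y :* (w :- o)))
      refl x y o o′ v v′ w w′ s)
    (trans (cong₂ (λ d e → (1# - s) * d + s * e) V≡0 W≡0)
      (solve 1 (λ s → (:1 :- s) :* :0 :+ s :* :0 := :0) refl s))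

  -- Unit-speed motion along a segment, and affine motion.

  along : Point → Point → ℝ → Point
  along V V′ t = V ⊕ (t / dist V V′) · (V′ ⊖ V)

  -- On a segment of length zero the quotient `t / dist V V′` is unspecified. Its value is
  -- immaterial there because `V′ ⊖ V` vanishes, and the parameter `0#` is supplied instead. The
  -- case does occur: an agent that starts at a vertex may have a first leg of length zero.
  along-parameter : ∀ {t} V V′ → 0# ≤ t → t ≤ dist V V′ →
    ∃[ s ] 0# ≤ s × s ≤ 1# × s * dist V V′ ≡ t × along V V′ t ≡ V ⊕ s · (V′ ⊖ V)
  along-parameter {t} V V′ 0≤t t≤d with dist V V′ ≟ 0#
  ... | yes d≡0 = 0# , ≤-refl , 0≤1
    , trans (zeroˡ _) (antisym 0≤t (≤-trans t≤d (≤-reflexive d≡0)))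
    , subst (λ Z → V ⊕ (t / dist V V′) · (Z ⊖ V) ≡ V ⊕ 0# · (Z ⊖ V)) (dist≡0⇒≡ d≡0)
        (trans (⊕-self _ V) (sym (⊕-self 0# V)))
  ... | no d≢0 = t / dist V V′
    , *-nonneg 0≤t (⁻¹-nonneg (dist-nonneg V V′) d≢0)
    , *-cancelˡ-≤ (dist-nonneg V V′) d≢0
        (subst₂ _≤_ (trans (sym (*-/-cancel t _ d≢0)) (*-comm _ _)) (sym (*-identityʳ _)) t≤d)
    , *-/-cancel t _ d≢0 , refl

  along-onSegment : ∀ {t} V V′ → 0# ≤ t → t ≤ dist V V′ → OnSegment V V′ (along V V′ t)
  along-onSegment V V′ 0≤t t≤d with along-parameter V V′ 0≤t t≤d
  ... | (s , 0≤s , s≤1 , _ , eq) = s , 0≤s , s≤1 , eq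

  dist-along : ∀ {t} V V′ → 0# ≤ t → t ≤ dist V V′ → dist V (along V V′ t) ≡ t
  dist-along V V′ 0≤t t≤d with along-parameter V V′ 0≤t t≤d
  ... | (s , 0≤s , s≤1 , sd≡t , eq) = trans (cong (dist V) eq) (trans (dist-segment V V′ 0≤s) sd≡t)

  along-flip : ∀ {s t} V V′ → s + t ≡ dist V V′ → along V V′ s ≡ along V′ V t
  along-flip {s} {t} V V′ s+t≡d with dist V V′ ≟ 0#
  ... | yes d≡0 = subst (λ Z → V ⊕ (s / dist V V′) · (Z ⊖ V) ≡ Z ⊕ (t / dist V′ V) · (V ⊖ Z)) (dist≡0⇒≡ d≡0)
                    (trans (⊕-self _ V) (sym (⊕-self _ V)))
  ... | no d≢0 = trans (segment-flip V V′ fractions) (cong (λ d → V′ ⊕ (t / d) · (V ⊖ V′)) (dist-sym V V′))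
    where
    fractions : s / dist V V′ + t / dist V V′ ≡ 1#
    fractions = trans (solve 3 (λ s t i → s :* i :+ t :* i := (s :+ t) :* i) refl s t (dist V V′ ⁻¹))
      (trans (cong (_/ dist V V′) s+t≡d) (*-inverseʳ _ d≢0))

  along-0 : ∀ V V′ → along V V′ 0# ≡ V
  along-0 (x , y) (x′ , y′) = cong₂ _,_ (eq _ x x′) (eq _ y y′)
    where
    eq : ∀ i x x′ → x + 0# * i * (x′ - x) ≡ x
    eq = solve 3 (λ i x x′ → x :+ :0 :* i :* (x′ :- x) := x) refl

  along-dist : ∀ V V′ → along V V′ (dist V V′) ≡ V′
  along-dist V V′ = trans (along-flip V V′ (+-identityʳ _)) (along-0 V′ V)

  -- The velocity `D` is arbitrary and the formula is required on an interval only, so that each leg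
  -- of a walk qualifies and two legs can be restricted to a common interval.
  Affine : (ℝ → Point) → ℝ → ℝ → Set
  Affine f t₀ t₁ = ∃[ O ] ∃[ D ] (∀ {t} → t₀ ≤ t → t ≤ t₁ → f t ≡ O ⊕ t · D)

  Affine-restrict : ∀ {f s₀ s₁ t₀ t₁} → s₀ ≤ t₀ → t₁ ≤ s₁ → Affine f s₀ s₁ → Affine f t₀ t₁
  Affine-restrict s₀≤t₀ t₁≤s₁ (O , D , eq) = O , D , λ t₀≤t t≤t₁ → eq (≤-trans s₀≤t₀ t₀≤t) (≤-trans t≤t₁ t₁≤s₁)

  along-affine : ∀ {f t₀ t₁} V V′ t* →
    (∀ {t} → t₀ ≤ t → t ≤ t₁ → f t ≡ along V V′ (t - t*)) → Affine f t₀ t₁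
  along-affine V@(x , y) V′@(x′ , y′) t* eq =
    V ⊖ t* · D , D , λ {t} t₀≤t t≤t₁ → trans (eq t₀≤t t≤t₁) (cong₂ _,_ (shift t x x′) (shift t y y′))
    where
    D : Point
    D = dist V V′ ⁻¹ · (V′ ⊖ V)
    shift : ∀ t x x′ → x + (t - t*) / dist V V′ * (x′ - x)
                     ≡ x - t* * (dist V V′ ⁻¹ * (x′ - x)) + t * (dist V V′ ⁻¹ * (x′ - x))
    shift t x x′ = solve 5 (λ t t* i x x′ → x :+ (t :- t*) :* i :* (x′ :- x)
      := x :- t* :* (i :* (x′ :- x)) :+ t :* (i :* (x′ :- x))) refl t t* (dist V V′ ⁻¹) x x′

  -- The distance of two points in affine motion is convex in time, so t + dist is maximal at an end of the interval.
  affine-bound : ∀ {f g t₀ t₁ K} → Affine f t₀ t₁ → Affine g t₀ t₁ →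
    t₀ + dist (f t₀) (g t₀) ≤ K → t₁ + dist (f t₁) (g t₁) ≤ K →
    ∀ {t} → t₀ ≤ t → t ≤ t₁ → t + dist (f t) (g t) ≤ K
  affine-bound {f} {g} {t₀} {t₁} {K} (O₁ , D₁ , f≡) (O₂ , D₂ , g≡) start end {t} t₀≤t t≤t₁ with t₁ - t₀ ≟ 0#
  ... | yes t₁-t₀≡0 = subst (λ t → t + dist (f t) (g t) ≤ K) (antisym t₀≤t t≤t₀) start
    where
    t≤t₀ : t ≤ t₀
    t≤t₀ = ≤-by-difference (+-mono-≤ t≤t₁ (≤-reflexive t₁-t₀≡0))
      (solve 3 (λ t t₀ t₁ → t₀ :- t := t₁ :+ :0 :- (t :+ (t₁ :- t₀))) refl t t₀ t₁)
  ... | no t₁-t₀≢0 = *-cancelˡ-≤ (sub-nonneg (≤-trans t₀≤t t≤t₁)) t₁-t₀≢0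
    (≤-by-difference (+-mono-≤ weighted (+-mono-≤ (*-monoˡ-≤ 0≤λ₀ start) (*-monoˡ-≤ 0≤λ₁ end)))
      (solve 7 (λ t t₀ t₁ n n₀ n₁ k →
        (t₁ :- t₀) :* k :- (t₁ :- t₀) :* (t :+ n)
          := (t₁ :- t) :* n₀ :+ (t :- t₀) :* n₁ :+ ((t₁ :- t) :* k :+ (t :- t₀) :* k)
             :- ((t₁ :- t₀) :* n :+ ((t₁ :- t) :* (t₀ :+ n₀) :+ (t :- t₀) :* (t₁ :+ n₁))))
        refl t t₀ t₁ (N t) (N t₀) (N t₁) K))
    where
    N : ℝ → ℝ
    N s = dist (f s) (g s)
    t₀≤t₁ : t₀ ≤ t₁
    t₀≤t₁ = ≤-trans t₀≤t t≤t₁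
    0≤λ₀ : 0# ≤ t₁ - t
    0≤λ₀ = sub-nonneg t≤t₁
    0≤λ₁ : 0# ≤ t - t₀
    0≤λ₁ = sub-nonneg t₀≤t
    v : ℝ → Point
    v s = (O₁ ⊕ s · D₁) ⊖ (O₂ ⊕ s · D₂)
    N≡ : ∀ {s} → t₀ ≤ s → s ≤ t₁ → N s ≡ ‖ v s ‖
    N≡ l u = cong₂ dist (f≡ l u) (g≡ l u)
    interpolate : ∀ o₁ d₁ o₂ d₂ →
      (t₁ - t) * (o₁ + t₀ * d₁ - (o₂ + t₀ * d₂)) + (t - t₀) * (o₁ + t₁ * d₁ - (o₂ + t₁ * d₂))
        ≡ (t₁ - t₀) * (o₁ + t * d₁ - (o₂ + t * d₂))
    interpolate o₁ d₁ o₂ d₂ = solve 7 (λ t t₀ t₁ o₁ d₁ o₂ d₂ →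
      (t₁ :- t) :* (o₁ :+ t₀ :* d₁ :- (o₂ :+ t₀ :* d₂)) :+ (t :- t₀) :* (o₁ :+ t₁ :* d₁ :- (o₂ :+ t₁ :* d₂))
        := (t₁ :- t₀) :* (o₁ :+ t :* d₁ :- (o₂ :+ t :* d₂))) refl t t₀ t₁ o₁ d₁ o₂ d₂
    weighted : (t₁ - t₀) * N t ≤ (t₁ - t) * N t₀ + (t - t₀) * N t₁
    weighted = subst₂ _≤_
      (trans (cong ‖_‖ (cong₂ _,_ (interpolate _ _ _ _) (interpolate _ _ _ _)))
        (trans (‖‖-· (sub-nonneg t₀≤t₁) (v t)) (cong ((t₁ - t₀) *_) (sym (N≡ t₀≤t t≤t₁)))))
      (cong₂ _+_
        (trans (‖‖-· 0≤λ₀ (v t₀)) (cong ((t₁ - t) *_) (sym (N≡ ≤-refl t₀≤t₁))))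
        (trans (‖‖-· 0≤λ₁ (v t₁)) (cong ((t - t₀) *_) (sym (N≡ t₀≤t₁ ≤-refl)))))
      (‖‖-⊕ ((t₁ - t) · v t₀) ((t - t₀) · v t₁))

-- Trajectories of the agents.

module Search (R : RealNumbers) where
  open RealNumbers R
  open Plane R
  open OrderedField R
  open PlaneGeometry R

  walk-start : ∀ P V Vs {t} → t ≤ dist P V → walk P (V ∷ Vs) t ≡ along P V t
  walk-start P V Vs {t} t≤d with t ≤? dist P V
  ... | yes _   = refl
  ... | no t≰d = ⊥-elim (t≰d t≤d)

  walk-0 : ∀ P Vs → walk P Vs 0# ≡ P
  walk-0 P []       = refl
  walk-0 P (V ∷ Vs) = trans (walk-start P V Vs (dist-nonneg P V)) (along-0 P V)

  -- At `t ≡ dist P V` the test in `walk` still selects the first leg. Both legs give `V` at that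
  -- moment, so the legs can be described on closed intervals that share their ends.
  walk-next : ∀ P V Vs {t} → dist P V ≤ t → walk P (V ∷ Vs) t ≡ walk V Vs (t - dist P V)
  walk-next P V Vs {t} d≤t with t ≤? dist P V
  ... | no _    = refl
  ... | yes t≤d with antisym t≤d d≤t
  ...   | refl = trans (along-dist P V) (sym (trans (cong (walk V Vs) (-‿inverseʳ _)) (walk-0 V Vs)))

  -- Unit speed and the triangle inequality, leg by leg. It bounds the cost at early times, and
  -- shows that no agent reaches a point sooner than in a straight line.
  dist-walk-≤ : ∀ P Vs {t} → 0# ≤ t → dist P (walk P Vs t) ≤ t
  dist-walk-≤ P []       0≤t = subst (_≤ _) (sym (dist-self P)) 0≤t
  dist-walk-≤ P (V ∷ Vs) {t} 0≤t with total t (dist P V)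
  ... | inj₁ t≤d = ≤-reflexive (trans (cong (dist P) (walk-start P V Vs t≤d)) (dist-along P V 0≤t t≤d))
  ... | inj₂ d≤t = subst (λ Q → dist P Q ≤ t) (sym (walk-next P V Vs d≤t))
    (≤-trans (dist-triangle P V _)
      (≤-by-difference (dist-walk-≤ V Vs (sub-nonneg d≤t))
        (solve 3 (λ t d e → t :- (d :+ e) := t :- d :- e) refl t (dist P V) (dist V (walk V Vs (t - dist P V))))))

  -- The agent that leaves P ∈ XY towards Y; exchanging X and Y gives the other agent.
  agent : Point → Point → Point → Point → ℝ → Point
  agent X Y Z P = walk P (Y ∷ Z ∷ X ∷ P ∷ [])

  cost : Point → Point → Point → Point → ℝ → ℝ
  cost X Y Z P t = t + dist (agent X Y Z P t) (agent Y X Z P t)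

  cost-swap : ∀ X Y Z P t → cost Y X Z P t ≡ cost X Y Z P t
  cost-swap X Y Z P t = cong (t +_) (dist-sym (agent Y X Z P t) (agent X Y Z P t))

  module Agent (X Y Z P : Point) where
    f = agent X Y Z P
    q = dist P Y
    x = dist Y Z

    leg₁ : ∀ {t} → t ≤ q → f t ≡ along P Y t
    leg₁ = walk-start P Y (Z ∷ X ∷ P ∷ [])

    leg₂ : ∀ {t} → q ≤ t → t ≤ q + x → f t ≡ along Y Z (t - q)
    leg₂ {t} q≤t t≤q+x = trans (walk-next P Y (Z ∷ X ∷ P ∷ []) q≤t)
      (walk-start Y Z (X ∷ P ∷ []) (≤-by-difference t≤q+x (solve 3 (λ t q x → x :- (t :- q) := q :+ x :- t) refl t q x)))

    leg₃ : ∀ {t} → q + x ≤ t → t ≤ q + x + dist Z X → f t ≡ along Z X (t - (q + x))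
    leg₃ {t} q+x≤t t≤end = trans (walk-next P Y (Z ∷ X ∷ P ∷ []) q≤t) (trans
      (walk-next Y Z (X ∷ P ∷ []) (≤-by-difference q+x≤t (solve 3 (λ t q x → t :- q :- x := t :- (q :+ x)) refl t q x)))
      (trans (walk-start Z X (P ∷ []) (≤-by-difference t≤end
        (solve 4 (λ t q x y → y :- (t :- q :- x) := q :+ x :+ y :- t) refl t q x (dist Z X))))
      (cong (along Z X) (solve 3 (λ t q x → t :- q :- x := t :- (q :+ x)) refl t q x))))
      where
      q≤t : q ≤ t
      q≤t = ≤-by-difference (+-mono-≤ q+x≤t (dist-nonneg Y Z))
        (solve 3 (λ t q x → t :- q := t :+ x :- (q :+ x :+ :0)) refl t q x)

    affine₁ : Affine f 0# q
    affine₁ = along-affine P Y 0# λ {t} _ t≤q →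
      trans (leg₁ t≤q) (cong (along P Y) (solve 1 (λ t → t := t :- :0) refl t))

    affine₂ : Affine f q (q + x)
    affine₂ = along-affine Y Z q leg₂

    affine₃ : Affine f (q + x) (q + x + dist Z X)
    affine₃ = along-affine Z X (q + x) leg₃

  -- The last side is written `dist X Z` so that exchanging `X` and `Y` yields data of the same
  -- shape. Through `swap` one may then assume which agent turns first, or which reaches `Z` first.
  record Start (X Y Z P : Point) (h : ℝ) : Set where
    field
      onEdge   : OnSegment X Y P
      half     : h + h ≡ dist X Y + dist Y Z + dist X Z
      XY≤YZ    : dist X Y ≤ dist Y Z
      XY≤XZ    : dist X Y ≤ dist X Z

  swap : ∀ {X Y Z P h} → Start X Y Z P h → Start Y X Z P h
  swap {X} {Y} {Z} S = record
    { onEdge = OnSegment-sym onEdge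
    ; half   = trans half (trans
        (solve 3 (λ c x y → c :+ x :+ y := c :+ y :+ x) refl (dist X Y) (dist Y Z) (dist X Z))
        (cong (λ c → c + dist X Z + dist Y Z) (dist-sym X Y)))
    ; XY≤YZ  = subst (_≤ dist X Z) (dist-sym X Y) XY≤XZ
    ; XY≤XZ  = subst (_≤ dist Y Z) (dist-sym X Y) XY≤YZ
    }
    where open Start S

  -- Turning times of the two agents, and the cost at `Z` and at the meeting.

  module Run {X Y Z P : Point} {h : ℝ} (S : Start X Y Z P h) where
    open Start S public
    open Agent X Y Z P public
    open Agent Y X Z P public
      renaming (f to g; q to p; x to y; leg₁ to leg₁′; leg₂ to leg₂′; leg₃ to leg₃′
               ; affine₁ to affine₁′; affine₂ to affine₂′; affine₃ to affine₃′)

    c = dist X Y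

    0≤p : 0# ≤ p
    0≤p = dist-nonneg P X

    0≤q : 0# ≤ q
    0≤q = dist-nonneg P Y

    0≤x : 0# ≤ x
    0≤x = dist-nonneg Y Z

    p+q≡c : p + q ≡ c
    p+q≡c = OnSegment⇒dist+dist onEdge

    p+q≤y : p + q ≤ y
    p+q≤y = subst (_≤ y) (sym p+q≡c) XY≤XZ

    h+h : h + h ≡ p + y + (q + x)
    h+h = trans half (trans (cong (λ c → c + x + y) (sym p+q≡c))
      (solve 4 (λ p q x y → p :+ q :+ x :+ y := p :+ y :+ (q :+ x)) refl p q x y))

    -- Since `XY` is a shortest side, `q ≤ p + q ≤ y`: the agent `f` has passed `Y` by the time `g`
    -- reaches `Z`.
    q≤p+y : q ≤ p + y
    q≤p+y = ≤-by-difference (+-mono-≤ p+q≤y (+-nonneg 0≤p 0≤p))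
      (solve 3 (λ p q y → p :+ y :- q := y :+ (p :+ p) :- (p :+ q :+ :0)) refl p q y)

    -- By `h+h`, `h` is the mean of `p + y` and `q + x`, the lengths of the two routes from `P` to
    -- `Z`.
    h-between : ∀ {l u} → l ≤ p + y → l ≤ q + x → p + y ≤ u → q + x ≤ u → l ≤ h × h ≤ u
    h-between {l} {u} l₁ l₂ u₁ u₂ = halve (subst (l + l ≤_) (sym h+h) (+-mono-≤ l₁ l₂))
                          , halve (subst (_≤ u + u) (sym h+h) (+-mono-≤ u₁ u₂))

    p+y≤h : p + y ≤ q + x → p + y ≤ h
    p+y≤h le = proj₁ (h-between ≤-refl le le ≤-refl)

    h≤q+x : p + y ≤ q + x → h ≤ q + x
    h≤q+x le = proj₂ (h-between ≤-refl le le ≤-refl)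

    f-at-Y : f q ≡ Y
    f-at-Y = trans (leg₁ ≤-refl) (along-dist P Y)

    g-at-Z : g (p + y) ≡ Z
    g-at-Z = trans (leg₂′ (≤-by-difference (dist-nonneg X Z) (solve 2 (λ p y → p :+ y :- p := y :- :0) refl p y)) ≤-refl)
      (trans (cong (along X Z) (solve 2 (λ p y → p :+ y :- p := y) refl p y)) (along-dist X Z))

    f-h : p + y ≤ q + x → f h ≡ along Y Z (h - q)
    f-h le = leg₂ (≤-trans q≤p+y (p+y≤h le)) (h≤q+x le)

    h≤end : p + y ≤ q + x → h ≤ p + y + dist Z Y
    h≤end le = subst (h ≤_) (cong (p + y +_) (dist-sym Y Z)) (≤-by-difference (+-mono-≤ (h≤q+x le) q≤p+y)
      (solve 5 (λ p q x y h → p :+ y :+ x :- h := q :+ x :+ (p :+ y) :- (h :+ q)) refl p q x y h))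

    g-h : p + y ≤ q + x → g h ≡ along Z Y (h - (p + y))
    g-h le = leg₃′ (p+y≤h le) (h≤end le)

    -- Both agents are on `YZ` at time `h`, and the lengths they have covered from its two ends add
    -- up to `x`.
    meet : p + y ≤ q + x → f h ≡ g h
    meet le = trans (f-h le) (trans (along-flip Y Z complementary) (sym (g-h le)))
      where
      complementary : h - q + (h - (p + y)) ≡ x
      complementary = trans
        (solve 4 (λ h p q y → h :- q :+ (h :- (p :+ y)) := h :+ h :- q :- (p :+ y)) refl h p q y)
        (trans (cong (λ k → k - q - (p + y)) h+h)
          (solve 4 (λ p q x y → p :+ y :+ (q :+ x) :- q :- (p :+ y) := x) refl p q x y))

    -- When `g` reaches `Z`, `f` has the rest of `YZ` ahead of it. Elapsed time plus this remainder
    -- is the full length of the route of `f` to `Z`.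
    cost-at-Z : p + y ≤ q + x → cost X Y Z P (p + y) ≡ q + x
    cost-at-Z le = trans (cong (p + y +_) gap) (solve 4 (λ p q x y → p :+ y :+ (x :- (p :+ y :- q)) := q :+ x) refl p q x y)
      where
      τ = p + y - q
      0≤x-τ : 0# ≤ x - τ
      0≤x-τ = ≤-by-difference le (solve 4 (λ p q x y → x :- (p :+ y :- q) :- :0 := q :+ x :- (p :+ y)) refl p q x y)
      x-τ≤x : x - τ ≤ dist Z Y
      x-τ≤x = subst (x - τ ≤_) (dist-sym Y Z) (≤-by-difference q≤p+y
        (solve 4 (λ p q x y → x :- (x :- (p :+ y :- q)) := p :+ y :- q) refl p q x y))
      f≡ : f (p + y) ≡ along Z Y (x - τ)
      f≡ = trans (leg₂ q≤p+y le) (along-flip Y Z (solve 2 (λ τ x → τ :+ (x :- τ) := x) refl τ x))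
      gap : dist (f (p + y)) (g (p + y)) ≡ x - τ
      gap = trans (cong₂ dist f≡ g-at-Z) (trans (dist-sym _ Z) (dist-along Z Y 0≤x-τ x-τ≤x))

    cost-at-h : p + y ≤ q + x → cost X Y Z P h ≡ h
    cost-at-h le = trans (cong (λ Q → h + dist Q (g h)) (meet le)) (trans (cong (h +_) (dist-self (g h))) (+-identityʳ h))

    -- Each agent is within `t` of `P`. The crude bound is good enough at the start and at the first
    -- turn.
    cost-≤-3t : ∀ {t} → 0# ≤ t → cost X Y Z P t ≤ t + (t + t)
    cost-≤-3t {t} 0≤t = +-mono-≤ ≤-refl (≤-trans (dist-triangle (f t) P (g t))
      (+-mono-≤ (subst (_≤ t) (dist-sym P (f t)) (dist-walk-≤ P (Y ∷ Z ∷ X ∷ P ∷ []) 0≤t)) (dist-walk-≤ P (X ∷ Z ∷ Y ∷ P ∷ []) 0≤t)))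

    -- Upper bounds for the cost at the turning times and between them.

    module Bound {K : ℝ} (q+x≤K : q + x ≤ K) (p+y≤K : p + y ≤ K) where

      0≤K : 0# ≤ K
      0≤K = ≤-trans (+-nonneg 0≤q 0≤x) q+x≤K

      cost-at-P : cost X Y Z P 0# ≤ K
      cost-at-P = ≤-trans (cost-≤-3t ≤-refl) (subst (_≤ K) (solve 0 (:0 := :0 :+ (:0 :+ :0)) refl) 0≤K)

      -- Here `p + p ≤ p + q ≤ y`, hence three times `p` is at most `p + y`.
      cost-at-X : p ≤ q → cost X Y Z P p ≤ K
      cost-at-X p≤q = ≤-trans (cost-≤-3t 0≤p) (≤-by-difference (+-mono-≤ p+y≤K (+-mono-≤ p≤q p+q≤y))
        (solve 4 (λ p q y k → k :- (p :+ (p :+ p)) := k :+ (q :+ y) :- (p :+ y :+ (p :+ (p :+ q)))) refl p q y K))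

      -- At time `q` the agent `g` is on `XZ`. Both ends of that side are within `x` of `Y`, because
      -- `XY` is no longer than `YZ`, so by convexity `g` is too.
      cost-at-Y : p ≤ q → cost X Y Z P q ≤ K
      cost-at-Y p≤q = ≤-trans (+-mono-≤ ≤-refl gap) q+x≤K
        where
        q-p≤y : q - p ≤ y
        q-p≤y = ≤-by-difference q≤p+y (solve 3 (λ p q y → y :- (q :- p) := p :+ y :- q) refl p q y)
        gap : dist (f q) (g q) ≤ x
        gap = subst₂ (λ Q Q′ → dist Q Q′ ≤ x) (sym f-at-Y) (sym (leg₂′ p≤q q≤p+y))
          (dist-segment-≤ Y (along-onSegment X Z (sub-nonneg p≤q) q-p≤y)
            (subst (_≤ x) (dist-sym X Y) XY≤YZ) ≤-refl)

      -- The end `m` will be the earlier arrival time at `Z`. It is kept general because the agent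
      -- that turns first at `X` or `Y` need not be the one that reaches `Z` first.
      bound-before : p ≤ q → ∀ {m} → q ≤ m → m ≤ q + x → m ≤ p + y → cost X Y Z P m ≤ K →
        ∀ {t} → 0# ≤ t → t ≤ m → cost X Y Z P t ≤ K
      bound-before p≤q {m} q≤m m≤q+x m≤p+y cost-m {t} 0≤t t≤m with total t p | total t q
      ... | inj₁ t≤p | _ = affine-bound (Affine-restrict ≤-refl p≤q affine₁) affine₁′ cost-at-P (cost-at-X p≤q) 0≤t t≤p
      ... | inj₂ p≤t | inj₁ t≤q = affine-bound
              (Affine-restrict 0≤p ≤-refl affine₁) (Affine-restrict ≤-refl q≤p+y affine₂′) (cost-at-X p≤q) (cost-at-Y p≤q) p≤t t≤q
      ... | inj₂ _   | inj₂ q≤t = affine-bound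
              (Affine-restrict ≤-refl m≤q+x affine₂) (Affine-restrict p≤q m≤p+y affine₂′) (cost-at-Y p≤q) cost-m q≤t t≤m

      bound-after : p + y ≤ q + x → ∀ {t} → p + y ≤ t → t ≤ h → cost X Y Z P t ≤ K
      bound-after le = affine-bound
        (Affine-restrict q≤p+y (h≤q+x le) affine₂) (Affine-restrict ≤-refl (h≤end le) affine₃′)
        (subst (_≤ K) (sym (cost-at-Z le)) q+x≤K)
        (subst (_≤ K) (sym (cost-at-h le)) (≤-trans (h≤q+x le) q+x≤K))

    -- The meeting point is not visited before the meeting.

    module FirstVisit (isTriangle : IsTriangle X Y Z) (le : p + y ≤ q + x) where

      M : Point
      M = f h

      q≤h : q ≤ h
      q≤h = ≤-trans q≤p+y (p+y≤h le)

      0≤h-q : 0# ≤ h - q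
      0≤h-q = sub-nonneg q≤h

      h-q≤x : h - q ≤ x
      h-q≤x = ≤-by-difference (h≤q+x le) (solve 3 (λ q x h → x :- (h :- q) := q :+ x :- h) refl q x h)

      M-onSegment : OnSegment Y Z M
      M-onSegment = subst (OnSegment Y Z) (sym (f-h le)) (along-onSegment Y Z 0≤h-q h-q≤x)

      u : ℝ
      u = proj₁ M-onSegment

      M≡ : M ≡ Y ⊕ u · (Z ⊖ Y)
      M≡ = proj₂ (proj₂ (proj₂ M-onSegment))

      dist-Y-M : dist Y M ≡ h - q
      dist-Y-M = trans (cong (dist Y) (f-h le)) (dist-along Y Z 0≤h-q h-q≤x)

      u*x≡h-q : u * x ≡ h - q
      u*x≡h-q = trans (sym (dist-segment Y Z (proj₁ (proj₂ M-onSegment)))) (trans (cong (dist Y) (sym M≡)) dist-Y-M)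

      h≡-from-u : ∀ {k} → u ≡ k → h ≡ q + k * x
      h≡-from-u {k} u≡k = trans (solve 2 (λ h q → h := q :+ (h :- q)) refl h q)
        (cong (q +_) (trans (sym u*x≡h-q) (cong (_* x) u≡k)))

      D : ℝ
      D = det (Y ⊖ X) (Z ⊖ X)

      -- As a function of the parameter on `YZ`, the determinant for the line `XY` or `XZ` is `D`
      -- times `u - k`, where `k` is `0#` at `Y` and `1#` at `Z`. Nondegeneracy of the triangle
      -- allows cancelling `D`.
      u-from-det : ∀ {k d} → d ≡ 0# → d ≡ D * (u - k) → u ≡ k
      u-from-det {k} {d} d≡0 d≡ = trans (solve 2 (λ u k → u := u :- k :+ k) refl u k)
        (trans (cong (_+ k) (*-cancelˡ isTriangle (trans (sym d≡) (trans d≡0 (sym (zeroʳ D)))))) (+-identityˡ k))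

      -- The line XY meets the side YZ in Y only, and M = Y would force x = 0.
      M-not-on-XY : det (Y ⊖ X) (M ⊖ X) ≢ 0#
      M-not-on-XY det≡0 = isTriangle (trans (cong (λ Z → det (Y ⊖ X) (Z ⊖ X)) (sym Y≡Z)) (det-self (Y ⊖ X)))
        where
        det≡ : ∀ X Y Z u → det (Y ⊖ X) (Y ⊕ u · (Z ⊖ Y) ⊖ X) ≡ det (Y ⊖ X) (Z ⊖ X) * (u - 0#)
        det≡ (x , x′) (y , y′) (z , z′) u = solve 7 (λ x x′ y y′ z z′ u →
          (y :- x) :* (y′ :+ u :* (z′ :- y′) :- x′) :- (y′ :- x′) :* (y :+ u :* (z :- y) :- x)
            := ((y :- x) :* (z′ :- x′) :- (y′ :- x′) :* (z :- x)) :* (u :- :0)) refl x x′ y y′ z z′ u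
        h≡q : h ≡ q + 0# * x
        h≡q = h≡-from-u (u-from-det det≡0 (trans (cong (λ M → det (Y ⊖ X) (M ⊖ X)) M≡) (det≡ X Y Z u)))
        -- If `h` equals `q`, then `h+h` turns into `q ≡ p + y + x`, whereas `y` is at least
        -- `p + q`.
        x≤0 : x ≤ 0#
        x≤0 = ≤-by-difference
          (+-mono-≤ (+-mono-≤ (≤-reflexive (sym h+h)) (+-mono-≤ (≤-reflexive h≡q) (≤-reflexive h≡q)))
            (+-mono-≤ p+q≤y (+-nonneg 0≤p 0≤p)))
          (solve 5 (λ p q x y h → :0 :- x
            := h :+ h :+ (q :+ :0 :* x :+ (q :+ :0 :* x)) :+ (y :+ (p :+ p))
               :- (p :+ y :+ (q :+ x) :+ (h :+ h) :+ (p :+ q :+ :0))) refl p q x y h)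
        Y≡Z : Y ≡ Z
        Y≡Z = dist≡0⇒≡ (antisym x≤0 0≤x)

      -- The line `XZ` meets the side `YZ` in `Z` only, so `M` has parameter `1#`.
      M-on-XZ : det (Z ⊖ X) (M ⊖ X) ≡ 0# → h ≡ q + 1# * x
      M-on-XZ det≡0 = h≡-from-u (u-from-det det≡0 (trans (cong (λ M → det (Z ⊖ X) (M ⊖ X)) M≡) (det≡ X Y Z u)))
        where
        det≡ : ∀ X Y Z u → det (Z ⊖ X) (Y ⊕ u · (Z ⊖ Y) ⊖ X) ≡ det (Y ⊖ X) (Z ⊖ X) * (u - 1#)
        det≡ (x , x′) (y , y′) (z , z′) u = solve 7 (λ x x′ y y′ z z′ u →
          (z :- x) :* (y′ :+ u :* (z′ :- y′) :- x′) :- (z′ :- x′) :* (y :+ u :* (z :- y) :- x)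
            := ((y :- x) :* (z′ :- x′) :- (y′ :- x′) :* (z :- x)) :* (u :- :1)) refl x x′ y y′ z z′ u

      P-on-XY : det (Y ⊖ X) (P ⊖ X) ≡ 0#
      P-on-XY = det-segment (Y ⊖ X) X onEdge (det-⊖-self (Y ⊖ X) X) (det-self (Y ⊖ X))

      -- By legs: on the first leg either agent is on the line `XY`, which misses `M`. When an agent
      -- is on `YZ`, its distance from the end where it entered determines the time. The remaining
      -- case is `g` on `XZ`.
      h≤-visit : ∀ {s} → 0# ≤ s → s ≤ h → f s ≡ M ⊎ g s ≡ M → h ≤ s
      h≤-visit {s} 0≤s s≤h (inj₁ fs≡M) with total s q
      ... | inj₁ s≤q = ⊥-elim (M-not-on-XY (subst (λ N → det (Y ⊖ X) (N ⊖ X) ≡ 0#) (trans (sym (leg₁ s≤q)) fs≡M)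
              (det-segment (Y ⊖ X) X (along-onSegment P Y 0≤s s≤q) P-on-XY (det-self (Y ⊖ X)))))
      ... | inj₂ q≤s = ≤-by-difference (≤-reflexive h-q≡s-q)
              (solve 3 (λ h s q → s :- h := s :- q :- (h :- q)) refl h s q)
        where
        s≤q+x : s ≤ q + x
        s≤q+x = ≤-trans s≤h (h≤q+x le)
        h-q≡s-q : h - q ≡ s - q
        h-q≡s-q = trans (sym dist-Y-M) (trans (cong (dist Y) (trans (sym fs≡M) (leg₂ q≤s s≤q+x)))
          (dist-along Y Z (sub-nonneg q≤s)
            (≤-by-difference s≤q+x (solve 3 (λ q x s → x :- (s :- q) := q :+ x :- s) refl q x s))))
      h≤-visit {s} 0≤s s≤h (inj₂ gs≡M) with total s p | total s (p + y)
      ... | inj₁ s≤p | _ = ⊥-elim (M-not-on-XY (subst (λ N → det (Y ⊖ X) (N ⊖ X) ≡ 0#) (trans (sym (leg₁′ s≤p)) gs≡M)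
              (det-segment (Y ⊖ X) X (along-onSegment P X 0≤s s≤p) P-on-XY (det-⊖-self (Y ⊖ X) X))))
      -- Now `M` lies on `XZ`, so `M` is `Z` and `h` equals `q + x`, hence also `p + y` by `h+h`.
      -- Since `g s` is `Z`, its distance `s - p` from `X` is `y`, and `s` equals `h`.
      ... | inj₂ p≤s | inj₁ s≤p+y = ≤-by-difference
              (+-mono-≤ (≤-reflexive y≡s-p) (+-mono-≤ (≤-reflexive h+h) (≤-reflexive (sym h≡q+x))))
              (solve 6 (λ p q x y h s → s :- h
                := s :- p :+ (p :+ y :+ (q :+ x) :+ h) :- (y :+ (h :+ h :+ (q :+ :1 :* x)))) refl p q x y h s)
        where
        g≡ : g s ≡ along X Z (s - p)
        g≡ = leg₂′ p≤s s≤p+y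
        s-p≤y : s - p ≤ y
        s-p≤y = ≤-by-difference s≤p+y (solve 3 (λ p y s → y :- (s :- p) := p :+ y :- s) refl p y s)
        h≡q+x : h ≡ q + 1# * x
        h≡q+x = M-on-XZ (subst (λ N → det (Z ⊖ X) (N ⊖ X) ≡ 0#) (trans (sym g≡) gs≡M)
          (det-segment (Z ⊖ X) X (along-onSegment X Z (sub-nonneg p≤s) s-p≤y) (det-⊖-self (Z ⊖ X) X) (det-self (Z ⊖ X))))
        M≡Z : M ≡ Z
        M≡Z = trans (f-h le) (trans
          (cong (along Y Z) (trans (cong (_- q) h≡q+x) (solve 2 (λ q x → q :+ :1 :* x :- q := x) refl q x)))
          (along-dist Y Z))
        y≡s-p : y ≡ s - p
        y≡s-p = trans (cong (dist X) (trans (sym M≡Z) (trans (sym gs≡M) g≡))) (dist-along X Z (sub-nonneg p≤s) s-p≤y)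
      ... | inj₂ _ | inj₂ p+y≤s = ≤-by-difference (≤-reflexive remaining≡)
              (solve 3 (λ h s q → s :- h := s :- q :- (h :- q)) refl h s (p + y))
        where
        dist-Z : ∀ {r} → p + y ≤ r → r ≤ h → dist Z (along Z Y (r - (p + y))) ≡ r - (p + y)
        dist-Z {r} p+y≤r r≤h = dist-along Z Y (sub-nonneg p+y≤r) (≤-by-difference (≤-trans r≤h (h≤end le))
          (solve 3 (λ r k x → x :- (r :- k) := k :+ x :- r) refl r (p + y) (dist Z Y)))
        remaining≡ : h - (p + y) ≡ s - (p + y)
        remaining≡ = trans (sym (dist-Z (p+y≤h le) ≤-refl))
          (trans (cong (dist Z) (trans (sym (g-h le)) (trans (sym (meet le)) (trans (sym gs≡M) (leg₃′ p+y≤s (≤-trans s≤h (h≤end le)))))))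
            (dist-Z p+y≤s s≤h))

  -- Reduction to a fixed order of the agents by exchanging `X` and `Y`.

  cost-bound-before : ∀ {X Y Z P h K m} (S : Start X Y Z P h) → let open Run S in
    q + x ≤ K → p + y ≤ K → p ≤ m → q ≤ m → m ≤ q + x → m ≤ p + y → cost X Y Z P m ≤ K →
    ∀ {t} → 0# ≤ t → t ≤ m → cost X Y Z P t ≤ K
  cost-bound-before {X} {Y} {Z} {P} {K = K} {m} S q+x≤K p+y≤K p≤m q≤m m≤q+x m≤p+y cost-m {t} 0≤t t≤m
    with total (dist P X) (dist P Y)
  ... | inj₁ p≤q = Run.Bound.bound-before S q+x≤K p+y≤K p≤q q≤m m≤q+x m≤p+y cost-m 0≤t t≤m
  ... | inj₂ q≤p = subst (_≤ K) (cost-swap X Y Z P t)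
    (Run.Bound.bound-before (swap S) p+y≤K q+x≤K q≤p p≤m m≤p+y m≤q+x
      (subst (_≤ K) (sym (cost-swap X Y Z P m)) cost-m) 0≤t t≤m)

  cost-bound-one-sided : ∀ {X Y Z P h K} (S : Start X Y Z P h) → let open Run S in
    p + y ≤ q + x → q + x ≤ K → p + y ≤ K → ∀ {t} → 0# ≤ t → t ≤ h → cost X Y Z P t ≤ K
  cost-bound-one-sided {K = K} S le q+x≤K p+y≤K {t} 0≤t t≤h with total t (Run.p S + Run.y S)
  ... | inj₁ t≤p+y = cost-bound-before S q+x≤K p+y≤K p≤p+y q≤p+y le ≤-refl
                       (subst (_≤ K) (sym (cost-at-Z le)) q+x≤K) 0≤t t≤p+y
    where
    open Run S
    p≤p+y : p ≤ p + y
    p≤p+y = ≤-by-difference (≤-trans (+-nonneg 0≤p 0≤q) p+q≤y) (solve 2 (λ p y → p :+ y :- p := y :- :0) refl p y)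
  ... | inj₂ p+y≤t = Run.Bound.bound-after S q+x≤K p+y≤K le p+y≤t t≤h

  -- The assumption on `K` and the cost are symmetric in the agents, so the one that reaches `Z`
  -- first may be taken to be `g`.
  cost-bound : ∀ {X Y Z P h K} (S : Start X Y Z P h) → let open Run S in
    q + x ≤ K → p + y ≤ K → ∀ {t} → 0# ≤ t → t ≤ h → cost X Y Z P t ≤ K
  cost-bound {X} {Y} {Z} {P} {K = K} S q+x≤K p+y≤K {t} 0≤t t≤h
    with total (dist P X + dist X Z) (dist P Y + dist Y Z)
  ... | inj₁ le = cost-bound-one-sided S le q+x≤K p+y≤K 0≤t t≤h
  ... | inj₂ le = subst (_≤ K) (cost-swap X Y Z P t) (cost-bound-one-sided (swap S) le p+y≤K q+x≤K 0≤t t≤h)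

  IsTriangle-swap : ∀ {X Y Z} → IsTriangle X Y Z → IsTriangle Y X Z
  IsTriangle-swap {x , x′} {y , y′} {z , z′} isTriangle eq = isTriangle (trans
    (solve 6 (λ x x′ y y′ z z′ → (y :- x) :* (z′ :- x′) :- (y′ :- x′) :* (z :- x)
      := :0 :- ((x :- y) :* (z′ :- y′) :- (x′ :- y′) :* (z :- y))) refl x x′ y y′ z z′)
    (trans (cong (λ d → 0# - d) eq) (-‿inverseʳ 0#)))

  -- Which agent reaches `Z` first decides on which of the two longer sides they meet, hence the
  -- disjunction in `onPerimeter`.
  record Meeting (X Y Z P : Point) (h : ℝ) : Set where
    field
      onPerimeter : OnSegment Y Z (agent X Y Z P h) ⊎ OnSegment X Z (agent X Y Z P h)
      meets       : agent X Y Z P h ≡ agent Y X Z P h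
      h-nonneg    : 0# ≤ h
      firstVisit  : ∀ {s} → 0# ≤ s → s ≤ h → agent X Y Z P s ≡ agent X Y Z P h ⊎ agent Y X Z P s ≡ agent X Y Z P h → h ≤ s

  meeting : ∀ {X Y Z P h} → IsTriangle X Y Z → Start X Y Z P h → Meeting X Y Z P h
  meeting {X} {Y} {Z} {P} {h} isTriangle S with total (dist P X + dist X Z) (dist P Y + dist Y Z)
  ... | inj₁ le = record
    { onPerimeter = inj₁ M-onSegment
    ; meets       = meet le
    ; h-nonneg    = ≤-trans 0≤q q≤h
    ; firstVisit  = h≤-visit
    }
    where
    open Run S
    open FirstVisit isTriangle le
  ... | inj₂ le = record
    { onPerimeter = inj₂ (subst (OnSegment X Z) (meet le) M-onSegment)
    ; meets       = sym (meet le)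
    ; h-nonneg    = ≤-trans 0≤q q≤h
    ; firstVisit  = λ { 0≤s s≤h (inj₁ f≡) → h≤-visit 0≤s s≤h (inj₂ (trans f≡ (sym (meet le))))
                      ; 0≤s s≤h (inj₂ g≡) → h≤-visit 0≤s s≤h (inj₁ (trans g≡ (sym (meet le)))) }
    }
    where
    open Run (swap S)
    open FirstVisit (IsTriangle-swap isTriangle) le

  -- The worst case as a supremum.

  module WorstCase {X Y Z P : Point} (S : Start X Y Z P (OppositeSearch.halfPerimeter X Y Z P)) where
    open OppositeSearch X Y Z P
    open Run S using (p; q; x; y; 0≤p; 0≤q; 0≤x; p+y≤h; cost-at-Z; g-at-Z)

    EvacuationCost : ℝ → Set
    EvacuationCost e = ∃[ I ] OnPerimeter I × EvacuationTime I e

    -- Every evacuation time is a value of `cost` at a time between `0#` and the half perimeter,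
    -- whichever agent finds the exit.
    EvacuationCost-≤ : ∀ {K} → q + x ≤ K → p + y ≤ K → UpperBound EvacuationCost K
    EvacuationCost-≤ {K} q+x≤K p+y≤K e (I , _ , t , ((0≤t , t≤h , _) , _) , v) =
      subst (_≤ K) (sym (e≡ v)) (cost-bound S q+x≤K p+y≤K 0≤t t≤h)
      where
      e≡ : (agent₁ t ≡ I × e ≡ t + dist I (agent₂ t)) ⊎ (agent₂ t ≡ I × e ≡ t + dist I (agent₁ t)) →
           e ≡ cost X Y Z P t
      e≡ (inj₁ (refl , eq)) = eq
      e≡ (inj₂ (refl , eq)) = trans eq (cost-swap X Y Z P t)

    module _ (isTriangle : IsTriangle X Y Z) where
      open Meeting (meeting isTriangle S)

      halfPerimeter-cost : EvacuationCost halfPerimeter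
      halfPerimeter-cost = agent₁ halfPerimeter , onPerimeter′ onPerimeter , halfPerimeter
        , ((h-nonneg , ≤-refl , inj₁ refl) , λ { s (0≤s , s≤h , v) → firstVisit 0≤s s≤h v })
        , inj₁ (refl , sym (trans (cong (λ Q → halfPerimeter + dist (agent₁ halfPerimeter) Q) (sym meets))
            (trans (cong (halfPerimeter +_) (dist-self (agent₁ halfPerimeter))) (+-identityʳ halfPerimeter))))
        where
        onPerimeter′ : ∀ {I} → OnSegment Y Z I ⊎ OnSegment X Z I → OnPerimeter I
        onPerimeter′ (inj₁ I∈YZ) = inj₂ (inj₁ I∈YZ)
        onPerimeter′ (inj₂ I∈XZ) = inj₂ (inj₂ (OnSegment-sym I∈XZ))

      worstCase-isSupremum : IsSupremum EvacuationCost worstCase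
      worstCase-isSupremum = sup-isSupremum EvacuationCost (halfPerimeter , halfPerimeter-cost)
        -- `sup` is specified only for nonempty bounded sets. The sum of two nonnegative numbers
        -- serves as a bound above both.
        (q + x + (p + y) , EvacuationCost-≤
          (≤-by-difference 0≤p+y (solve 2 (λ k l → k :+ l :- k := l :- :0) refl (q + x) (p + y)))
          (≤-by-difference 0≤q+x (solve 2 (λ k l → k :+ l :- l := k :- :0) refl (q + x) (p + y))))
        where
        0≤q+x : 0# ≤ q + x
        0≤q+x = +-nonneg 0≤q 0≤x
        0≤p+y : 0# ≤ p + y
        0≤p+y = +-nonneg 0≤p (dist-nonneg X Z)

      worstCase-≤ : ∀ {K} → q + x ≤ K → p + y ≤ K → worstCase ≤ K
      worstCase-≤ {K} q+x≤K p+y≤K = proj₂ worstCase-isSupremum K (EvacuationCost-≤ q+x≤K p+y≤K)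

      halfPerimeter-≤-worstCase : halfPerimeter ≤ worstCase
      halfPerimeter-≤-worstCase = proj₁ worstCase-isSupremum halfPerimeter halfPerimeter-cost

      -- The exit is `Z`, with cost `q + x` by `cost-at-Z`. The second hypothesis makes `p + y` its
      -- first visiting time: no agent covers the straight distance from `P` to `Z` faster than in
      -- that time.
      vertex-≤-worstCase : p + y ≤ q + x → p + y ≤ dist P Z → q + x ≤ worstCase
      vertex-≤-worstCase le p+y≤PZ = proj₁ worstCase-isSupremum (q + x)
        ( Z , inj₂ (inj₁ (1# , 0≤1 , ≤-refl , Z-end))
        , p + y
        , ((+-nonneg 0≤p (dist-nonneg X Z) , p+y≤h le , inj₂ g-at-Z)
          , λ { s (0≤s , _ , inj₁ f≡Z) → first 0≤s (dist-walk-≤ P (Y ∷ Z ∷ X ∷ P ∷ []) 0≤s) f≡Z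
              ; s (0≤s , _ , inj₂ g≡Z) → first 0≤s (dist-walk-≤ P (X ∷ Z ∷ Y ∷ P ∷ []) 0≤s) g≡Z })
        , inj₂ (g-at-Z , e≡))
        where
        Z-end : Z ≡ Y ⊕ 1# · (Z ⊖ Y)
        Z-end = trans (sym (⊕-0 Z (Y ⊖ Z))) (segment-flip Z Y (+-identityˡ 1#))
        first : ∀ {s N} → 0# ≤ s → dist P N ≤ s → N ≡ Z → p + y ≤ s
        first 0≤s d≤s refl = ≤-trans p+y≤PZ d≤s
        e≡ : q + x ≡ p + y + dist Z (agent₁ (p + y))
        e≡ = trans (sym (cost-at-Z le)) (trans (sym (cost-swap X Y Z P (p + y)))
          (cong (λ N → p + y + dist N (agent₁ (p + y))) g-at-Z))

-- The extremal starting points on the shortest edge.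

lemma18 :
    (R : RealNumbers) →
    let open RealNumbers R
        open Plane R in
    (A B C : Point) →
    let a = dist B C
        b = dist C A
        c = dist A B in
    IsTriangle A B C →
    NonObtuse A B C →
    b ≤ a →
    c ≤ b →
    IsMinimumOver (OnSegment A B) (W A B C) ((a + b + c) / 2#) ×
    IsMaximumOver (OnSegment A B) (W A B C) (a + c)
lemma18 R A B C isTriangle _ b≤a c≤b =
    ( (balanced , balanced∈AB , antisym (worst-≤ balanced∈AB q+a≤h p+b≤h) (h≤worst balanced∈AB))
    , λ P P∈AB → h≤worst P∈AB)
  , ( (A , A∈AB , antisym (worst-≤a+c A∈AB) a+c≤worst)
    , λ P P∈AB → worst-≤a+c P∈AB)
  where
  open RealNumbers R
  open Plane R
  open OrderedField R
  open PlaneGeometry R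
  open Search R

  a b c h : ℝ
  a = dist B C
  b = dist C A
  c = dist A B
  h = (a + b + c) / 2#

  h+h≡ : h + h ≡ a + b + c
  h+h≡ = trans (solve 2 (λ s i → s :* i :+ s :* i := s :* i :* (:1 :+ :1)) refl (a + b + c) (2# ⁻¹)) (*-/-cancel _ 2# 2≢0)

  halfPerimeter≡h : (c + a + b) / 2# ≡ h
  halfPerimeter≡h = cong (_/ 2#) (solve 3 (λ a b c → c :+ a :+ b := a :+ b :+ c) refl a b c)

  b≡ : b ≡ dist A C
  b≡ = dist-sym C A

  start : ∀ {P} → OnSegment A B P → Start A B C P ((c + a + b) / 2#)
  start P∈AB = record
    { onEdge = P∈AB
    ; half   = trans (cong₂ _+_ halfPerimeter≡h halfPerimeter≡h) (trans h+h≡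
        (trans (solve 3 (λ a b c → a :+ b :+ c := c :+ a :+ b) refl a b c) (cong (c + a +_) b≡)))
    ; XY≤YZ  = ≤-trans c≤b b≤a
    ; XY≤XZ  = subst (c ≤_) b≡ c≤b
    }

  h≤worst : ∀ {P} → OnSegment A B P → h ≤ W A B C P
  h≤worst {P} P∈AB = subst (_≤ W A B C P) halfPerimeter≡h (WorstCase.halfPerimeter-≤-worstCase (start P∈AB) isTriangle)

  worst-≤ : ∀ {P K} → OnSegment A B P → dist P B + a ≤ K → dist P A + b ≤ K → W A B C P ≤ K
  worst-≤ {P} {K} P∈AB q+a≤K p+b≤K = WorstCase.worstCase-≤ (start P∈AB) isTriangle q+a≤K
    (subst (λ b → dist P A + b ≤ K) b≡ p+b≤K)

  worst-≤a+c : ∀ {P} → OnSegment A B P → W A B C P ≤ a + c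
  worst-≤a+c {P} P∈AB = worst-≤ P∈AB
    (≤-by-difference (+-mono-≤ p+q≤c (dist-nonneg P A))
      (solve 4 (λ a c p q → a :+ c :- (q :+ a) := c :+ p :- (p :+ q :+ :0)) refl a c (dist P A) (dist P B)))
    (≤-by-difference (+-mono-≤ p+q≤c (+-mono-≤ (dist-nonneg P B) b≤a))
      (solve 5 (λ a b c p q → a :+ c :- (p :+ b) := c :+ (q :+ a) :- (p :+ q :+ (:0 :+ b))) refl a b c (dist P A) (dist P B)))
    where
    p+q≤c : dist P A + dist P B ≤ c
    p+q≤c = ≤-reflexive (OnSegment⇒dist+dist P∈AB)

  A∈AB : OnSegment A B A
  A∈AB = 0# , ≤-refl , 0≤1 , sym (⊕-0 A (B ⊖ A))

  -- Starting at `A`, one agent has a first leg of length zero and then runs straight to `C`, so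
  -- `p + y` equals the distance from the start to `C`.
  a+c≤worst : a + c ≤ W A B C A
  a+c≤worst = subst (_≤ W A B C A) (+-comm c a)
    (WorstCase.vertex-≤-worstCase (start A∈AB) isTriangle p+b≤c+a (≤-reflexive p+b≡b))
    where
    p+b≡b : dist A A + dist A C ≡ dist A C
    p+b≡b = trans (cong (_+ dist A C) (dist-self A)) (+-identityˡ _)
    p+b≤c+a : dist A A + dist A C ≤ c + a
    p+b≤c+a = ≤-trans (≤-reflexive (trans p+b≡b (sym b≡)))
      (≤-by-difference (+-mono-≤ b≤a (dist-nonneg A B)) (solve 3 (λ a b c → c :+ a :- b := a :+ c :- (b :+ :0)) refl a b c))

  -- The starting point at distance p₀ from A is the one from which both agents reach C at time h.
  p₀ : ℝ
  p₀ = h - b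

  0≤p₀ : 0# ≤ p₀
  0≤p₀ = halve (≤-by-difference (+-mono-≤ (≤-reflexive (sym h+h≡)) (+-mono-≤ b≤a (dist-nonneg A B)))
    (solve 4 (λ a b c h → h :- b :+ (h :- b) :- (:0 :+ :0) := h :+ h :+ (a :+ c) :- (a :+ b :+ c :+ (b :+ :0))) refl a b c h))

  -- Doubling turns `p₀` into `a + c - b`, so the claim is the triangle inequality; in the same way
  -- `0≤p₀` comes from `b ≤ a`.
  p₀≤c : p₀ ≤ c
  p₀≤c = halve (≤-by-difference (+-mono-≤ (≤-reflexive h+h≡) a≤b+c)
    (solve 4 (λ a b c h → c :+ c :- (h :- b :+ (h :- b)) := a :+ b :+ c :+ (b :+ c) :- (h :+ h :+ a)) refl a b c h))
    where
    a≤b+c : a ≤ b + c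
    a≤b+c = subst₂ _≤_ (dist-sym C B) refl (dist-triangle C A B)

  balanced : Point
  balanced = along A B p₀

  balanced∈AB : OnSegment A B balanced
  balanced∈AB = along-onSegment A B 0≤p₀ p₀≤c

  p≡p₀ : dist balanced A ≡ p₀
  p≡p₀ = trans (dist-sym balanced A) (dist-along A B 0≤p₀ p₀≤c)

  p+b≤h : dist balanced A + b ≤ h
  p+b≤h = ≤-reflexive (trans (cong (_+ b) p≡p₀) (solve 2 (λ b h → h :- b :+ b := h) refl b h))

  -- By the choice of `p₀` both routes to `C` have length `h`: `c - p₀ + a` is `a + b + c - h`.
  q+a≤h : dist balanced B + a ≤ h
  q+a≤h = ≤-by-difference
    (+-mono-≤ (≤-reflexive (OnSegment⇒dist+dist balanced∈AB))
      (+-mono-≤ (≤-reflexive (sym p≡p₀)) (≤-reflexive (sym h+h≡))))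
    (solve 6 (λ a b c h p q → h :- (q :+ a) := c :+ (p :+ (h :+ h)) :- (p :+ q :+ (h :- b :+ (a :+ b :+ c))))
      refl a b c h (dist balanced A) (dist balanced B))
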